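{- For every constant $d>1$, every (deterministic) $d$-approximation algorithm for the sum of a sorted list of nonnegative numbers must, in the worst case, make $\Omega\!\left(\min\!\left(\log n,\ \log\frac{x_{max}}{x_{min}}\right)\right)$ (adaptive) queries to the input list, where $n$ is the length of the list and $x_{max}$ and $x_{min}$ are the largest and the least positive elements of the input list, respectively.
   Context: The input is a list $a_1\le a_2\le\cdots\le a_n$ of nonnegative reals sorted in nondecreasing order; the algorithm accesses it only by adaptive queries, each revealing one entry $a_i$. A real number $s$ is a $d$-approximation for the sum if $\frac{1}{d}\sum_{i=1}^n a_i\le s\le d\sum_{i=1}^n a_i$. -}

module Defs where

open import Level using (Level; suc; _⊔_)
open import Data.Nat.Base as ℕ using (ℕ)
open import Data.Fin.Base as Fin using (Fin)
open import Data.Product.Base using (∃-syntax; _×_; proj₁)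
open import Data.Sum.Base using (_⊎_; [_,_]′)
open import Data.Vec.Functional using (Vector)
open import Function.Base using (id; flip)
open import Relation.Nullary.Negation using (¬_; contradiction)
open import Relation.Binary.Core using (Rel)
open import Relation.Binary.Definitions using (Cotransitive)
open import Relation.Binary.Structures using (IsStrictPartialOrder)
open import Relation.Binary.Lattice.Definitions using (Infimum)
open import Algebra.Core using (Op₂)
open import Algebra.Bundles using (module CommutativeRing)
open import Algebra.Apartness.Bundles using (HeytingField; module HeytingCommutativeRing)
import Algebra.Definitions.RawMonoid as RawMonoid

-- The real numbers, characterised as a Cauchy complete Archimedean ordered
-- field.  The axioms are the constructive ones (cotransitivity of _<_ instead
-- of trichotomy), so that they do not rule out constructive models; with
-- excluded middle they determine ℝ up to isomorphism.

record RealNumbers (c ℓ₁ ℓ₂ : Level) : Set (suc (c ⊔ ℓ₁ ⊔ ℓ₂)) where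
  infix  4 _<_ _≤_
  infixl 7 _⊓_

  field
    heytingField : HeytingField c ℓ₁ ℓ₂

  open HeytingField heytingField public renaming (Carrier to ℝ)

  open RawMonoid
    (CommutativeRing.+-rawMonoid
      (HeytingCommutativeRing.commutativeRing heytingCommutativeRing)) public
    using (sum) renaming (_×_ to _·_)

  fromℕ : ℕ → ℝ
  fromℕ n = n · 1#

  field
    _<_                    : Rel ℝ ℓ₂
    <-isStrictPartialOrder : IsStrictPartialOrder _≈_ _<_
    <-cotrans              : Cotransitive _<_
    #⇒<⊎>                  : ∀ {x y} → x # y → x < y ⊎ y < x
    <⇒#                    : ∀ {x y} → x < y → x # y
    0<1                    : 0# < 1#
    +-monoˡ-<              : ∀ z {x y} → x < y → x + z < y + z
    *-pos                  : ∀ {x y} → 0# < x → 0# < y → 0# < x * y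

  module StrictOrder = IsStrictPartialOrder <-isStrictPartialOrder

  _≤_ : Rel ℝ ℓ₂
  x ≤ y = ¬ (y < x)

  field
    _⊓_         : Op₂ ℝ
    ⊓-infimum   : Infimum _≤_ _⊓_
    archimedean : ∀ x → ∃[ n ] x < fromℕ n

    -- The condition |x - y| < ε is written as x < y + ε together with
    -- y < x + ε; in the hypothesis, m and n range over both orders.
    complete    : (f : ℕ → ℝ) →
                  (∀ ε → 0# < ε → ∃[ N ] ∀ m n → N ℕ.≤ m → N ℕ.≤ n →
                     f m < f n + ε) →
                  ∃[ l ] ∀ ε → 0# < ε → ∃[ N ] ∀ n → N ℕ.≤ n →
                     f n < l + ε × l < f n + ε

  -- The inverse supplied by the field structure is that of x - 0#.
  inv : ∀ x → 0# < x → ℝ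
  inv x 0<x = proj₁ (#⇒invertible (#-sym (<⇒# 0<x)))

  fromℕ-pos : ∀ n → 0 ℕ.< n → 0# < fromℕ n
  fromℕ-pos 1                 _ = StrictOrder.<-respʳ-≈ (sym (+-identityʳ 1#)) 0<1
  fromℕ-pos (ℕ.suc (ℕ.suc n)) _ =
    StrictOrder.trans (fromℕ-pos (ℕ.suc n) (ℕ.s≤s ℕ.z≤n))
                      (StrictOrder.<-respˡ-≈ (+-identityˡ _) (+-monoˡ-< _ 0<1))

  1<⇒0< : ∀ {x} → 1# < x → 0# < x
  1<⇒0< = StrictOrder.trans 0<1

  1≤⇒0< : ∀ {x} → 1# ≤ x → 0# < x
  1≤⇒0< {x} 1≤x = [ id , flip contradiction 1≤x ]′ (<-cotrans 0<1 x)

-- These laws determine the base 2 logarithm on the positive reals.  (Another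
-- base would only change constant factors.)

record BinaryLogarithm {c ℓ₁ ℓ₂} (ℛ : RealNumbers c ℓ₁ ℓ₂) : Set (c ⊔ ℓ₁ ⊔ ℓ₂) where
  open RealNumbers ℛ

  field
    log₂      : ∀ x → 0# < x → ℝ
    log₂-mono : ∀ {x y} (0<x : 0# < x) (0<y : 0# < y) →
                x ≤ y → log₂ x 0<x ≤ log₂ y 0<y
    log₂-*    : ∀ {x y} (0<x : 0# < x) (0<y : 0# < y) →
                log₂ (x * y) (*-pos 0<x 0<y) ≈ log₂ x 0<x + log₂ y 0<y
    log₂-2    : log₂ (fromℕ 2) (fromℕ-pos 2 (ℕ.s≤s ℕ.z≤n)) ≈ 1#

module SortedSum {c ℓ₁ ℓ₂} (ℛ : RealNumbers c ℓ₁ ℓ₂) where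
  open RealNumbers ℛ

  record IsInput {n} (a : Vector ℝ n) : Set ℓ₂ where
    field
      nonneg : ∀ i → 0# ≤ a i
      sorted : ∀ {i j} → i Fin.≤ j → a i ≤ a j

  -- Adaptive deterministic algorithms on lists of length n: the next query,
  -- or the output, is a function of the answers received so far.

  data DecisionTree (n : ℕ) : Set c where
    output : ℝ → DecisionTree n
    query  : Fin n → (ℝ → DecisionTree n) → DecisionTree n

  run : ∀ {n} → DecisionTree n → Vector ℝ n → ℝ
  run (output s)  a = s
  run (query i k) a = run (k (a i)) a

  queries : ∀ {n} → DecisionTree n → Vector ℝ n → ℕ
  queries (output s)  a = 0
  queries (query i k) a = ℕ.suc (queries (k (a i)) a)

  Algorithm : Set c
  Algorithm = ∀ n → DecisionTree n

  IsApproximation : ∀ d → 0# < d → ∀ {n} → Vector ℝ n → ℝ → Set ℓ₂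
  IsApproximation d 0<d a s = inv d 0<d * sum a ≤ s × s ≤ d * sum a

  IsApproximationAlgorithm : ∀ d → 0# < d → Algorithm → Set (c ⊔ ℓ₂)
  IsApproximationAlgorithm d 0<d A =
    ∀ n (a : Vector ℝ n) → IsInput a → IsApproximation d 0<d a (run (A n) a)

  record IsLargestPositive {n} (a : Vector ℝ n) (x : ℝ) : Set (ℓ₁ ⊔ ℓ₂) where
    field
      positive : 0# < x
      attained : ∃[ i ] a i ≈ x
      largest  : ∀ i → 0# < a i → a i ≤ x

  record IsLeastPositive {n} (a : Vector ℝ n) (x : ℝ) : Set (ℓ₁ ⊔ ℓ₂) where
    field
      positive : 0# < x
      attained : ∃[ i ] a i ≈ x
      least    : ∀ i → 0# < a i → x ≤ a i

{-# OPTIONS --safe #-}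
module Submission where

-- Read from its large end, the hard input is a step function: the steps have
-- heights B^t, …, B, 1 and end at the positions 1, B, …, B^t, so that the sum
-- over each of them is about B^t.  Raising a step to the height of its
-- predecessor keeps the list sorted and multiplies the sum over that step by B.
-- If the algorithm leaves more than half of the steps unqueried, then raising
-- all of these goes unnoticed and, B being large compared with d², multiplies
-- the total by more than d².  Hence at least half of the t + 1 steps are queried,
-- and t can be chosen proportional to min(log n, log R).  A single entry
-- B^t / R ≤ 1 after the last step, followed by zeros, makes the ratio of the
-- extreme positive entries exactly R.

open import Defs
open import Algebra.Apartness.Bundles using (module HeytingCommutativeRing)
open import Algebra.Bundles using (CommutativeRing)
import Algebra.Apartness.Properties.HeytingCommutativeRing as HeytingProperties
import Algebra.Properties.AbelianGroup as AbelianGroupProperties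
import Algebra.Properties.Ring as RingProperties
import Algebra.Properties.Semiring.Mult as MultProperties
open import Data.Fin.Base as Fin using (Fin; toℕ; fromℕ<; opposite)
open import Data.Fin.Properties using (opposite-prop; opposite-involutive; toℕ-fromℕ<)
open import Data.List.Base using (List; []; _∷_; applyDownFrom; length; map)
open import Data.List.Membership.Propositional using (_∈_)
open import Data.List.Membership.Propositional.Properties using (∈-map⁺)
open import Data.List.Properties using (length-map)
open import Data.List.Relation.Unary.Any using (here; there)
open import Data.Nat.Base as ℕ using (ℕ; zero; suc; z≤n; s≤s)
import Data.Nat.ListAction as List
open import Data.Nat.Properties using (<-trans; n<1+n)
import Data.Nat.Properties as ℕ
open import Data.Nat.Tactic.RingSolver using (solve-∀)
open import Data.Product.Base using (Σ-syntax; ∃-syntax; _×_; _,_; proj₁; proj₂)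
open import Data.Sum.Base using (_⊎_; inj₁; inj₂; [_,_]′)
open import Data.Vec.Functional using (Vector)
open import Function.Base using (const; flip; id; _∘_)
open import Relation.Binary.Core using (_⇒_)
open import Relation.Binary.Definitions using (Trans; tri<; tri≈; tri>)
open import Relation.Binary.PropositionalEquality as ≡ using (_≡_)
import Relation.Binary.Reasoning.Base.Triple as Triple
open import Relation.Binary.Structures using (IsPreorder)
open import Relation.Nullary.Decidable using (yes; no)
open import Relation.Nullary.Negation using (¬_; contradiction)

-- Sums, query counts and step functions over the natural numbers.

module StepFunctions where
  open import Data.Nat.Base hiding (ℕ; zero; suc; z≤n; s≤s)
  open import Data.Nat.Properties
  open import Relation.Binary.PropositionalEquality hiding (_≡_)

  ∑ : ℕ → (ℕ → ℕ) → ℕ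
  ∑ n f = List.sum (applyDownFrom f n)

  ∑-cong : ∀ {f g} n → (∀ {j} → j < n → f j ≡ g j) → ∑ n f ≡ ∑ n g
  ∑-cong zero    f≗g = refl
  ∑-cong (suc n) f≗g = cong₂ _+_ (f≗g ≤-refl) (∑-cong n (f≗g ∘ m≤n⇒m≤1+n))

  ∑-distribˡ : ∀ x f n → ∑ n (λ j → x * f j) ≡ x * ∑ n f
  ∑-distribˡ x f zero    = sym (*-zeroʳ x)
  ∑-distribˡ x f (suc n) = trans (cong (x * f n +_) (∑-distribˡ x f n)) (sym (*-distribˡ-+ x (f n) _))

  ∑-tail-const : ∀ {f x m} k → (∀ {j} → m ≤ j → f j ≡ x) → ∑ (k + m) f ≡ ∑ m f + k * x
  ∑-tail-const zero    f≡x = sym (+-identityʳ _)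
  ∑-tail-const {f} {x} {m} (suc k) f≡x = begin
    f (k + m) + ∑ (k + m) f ≡⟨ cong₂ _+_ (f≡x (m≤n+m m k)) (∑-tail-const k f≡x) ⟩
    x + (∑ m f + k * x)     ≡⟨ lemma x (∑ m f) (k * x) ⟩
    ∑ m f + (x + k * x)     ∎
    where
    open ≡-Reasoning
    lemma : ∀ a b c → a + (b + c) ≡ b + (a + c)
    lemma = solve-∀

  -- A range of positions contains a query exactly when `count` is larger at its end than at its
  -- start. This test is decidable, and over consecutive ranges the increments add up to at most the
  -- length of the list.
  count : ℕ → List ℕ → ℕ
  count m []       = 0
  count m (q ∷ qs) with q <? m
  ... | yes _ = suc (count m qs)
  ... | no  _ = count m qs

  count-mono : ∀ {m m′} qs → m ≤ m′ → count m qs ≤ count m′ qs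
  count-mono [] m≤m′ = z≤n
  count-mono {m} {m′} (q ∷ qs) m≤m′ with q <? m | q <? m′
  ... | yes q<m | yes _    = s≤s (count-mono qs m≤m′)
  ... | yes q<m | no  q≮m′ = contradiction (<-≤-trans q<m m≤m′) q≮m′
  ... | no  _   | yes _    = m≤n⇒m≤1+n (count-mono qs m≤m′)
  ... | no  _   | no  _    = count-mono qs m≤m′

  count-strict : ∀ {m m′ q qs} → q ∈ qs → m ≤ q → q < m′ → count m qs < count m′ qs
  count-strict {m} {m′} {q} {_ ∷ qs} (here refl) m≤q q<m′ with q <? m | q <? m′
  ... | yes q<m | _       = contradiction m≤q (<⇒≱ q<m)
  ... | no _    | no q≮m′ = contradiction q<m′ q≮m′
  ... | no _    | yes _   = s≤s (count-mono qs (≤-trans m≤q (<⇒≤ q<m′)))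
  count-strict {m} {m′} {q} {p ∷ qs} (there q∈qs) m≤q q<m′ with p <? m | p <? m′
  ... | yes p<m | yes _    = s≤s (count-strict q∈qs m≤q q<m′)
  ... | yes p<m | no  p≮m′ = contradiction (<-trans p<m (≤-<-trans m≤q q<m′)) p≮m′
  ... | no  _   | yes _    = m≤n⇒m≤1+n (count-strict q∈qs m≤q q<m′)
  ... | no  _   | no  _    = count-strict q∈qs m≤q q<m′

  count≤length : ∀ m qs → count m qs ≤ length qs
  count≤length m []       = z≤n
  count≤length m (q ∷ qs) with q <? m
  ... | yes _ = s≤s (count≤length m qs)
  ... | no  _ = m≤n⇒m≤1+n (count≤length m qs)

  n<m^n : ∀ {m} → 1 < m → ∀ n → n < m ^ n
  n<m^n 1<m zero    = s≤s z≤n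
  n<m^n 1<m (suc n) = ≤-<-trans (n<m^n 1<m n) (^-monoʳ-< _ 1<m (n<1+n n))

  module Profile (B′ : ℕ) where

    B : ℕ
    B = suc B′

    -- The step k ≤ t has height u k * B ^ (t ∸ k); the last one is not cut off
    -- at position B ^ t.
    profile : (ℕ → ℕ) → ℕ → ℕ → ℕ
    profile u zero    j = u 0
    profile u (suc t) j with j <? B ^ t
    ... | yes _ = B * profile u t j
    ... | no  _ = u (suc t)

    profile-inside : ∀ u t {j} → j < B ^ t → profile u (suc t) j ≡ B * profile u t j
    profile-inside u t {j} j<B^t with j <? B ^ t
    ... | yes _    = refl
    ... | no j≮B^t = contradiction j<B^t j≮B^t

    profile-outside : ∀ u t {j} → B ^ t ≤ j → profile u (suc t) j ≡ u (suc t)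
    profile-outside u t {j} B^t≤j with j <? B ^ t
    ... | yes j<B^t = contradiction B^t≤j (<⇒≱ j<B^t)
    ... | no _      = refl

    module _ {u : ℕ → ℕ} (1≤u : ∀ k → 1 ≤ u k) where

      profile-pos : ∀ t j → 1 ≤ profile u t j
      profile-pos zero    j = 1≤u 0
      profile-pos (suc t) j with j <? B ^ t
      ... | yes _ = ≤-trans (profile-pos t j) (m≤m+n _ _)
      ... | no _  = 1≤u (suc t)

      -- Where the last step begins, the values before it are `B` times a positive number, hence at
      -- least `B`, which bounds `u (suc t)`.
      profile-antitone : (∀ k → u k ≤ B) → ∀ t {i j} → i ≤ j → profile u t j ≤ profile u t i
      profile-antitone u≤B zero    i≤j = ≤-refl
      profile-antitone u≤B (suc t) {i} {j} i≤j with i <? B ^ t | j <? B ^ t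
      ... | yes _   | yes _   = *-monoʳ-≤ B (profile-antitone u≤B t i≤j)
      ... | yes _   | no  _   = ≤-trans (u≤B (suc t)) (m≤m*n B (profile u t i) {{>-nonZero (profile-pos t i)}})
      ... | no  i≮  | yes j<  = contradiction (≤-<-trans i≤j j<) i≮
      ... | no  _   | no  _   = ≤-refl

    B^t>0 : ∀ t → 0 < B ^ t
    B^t>0 t = m^n>0 B t

    profile-first : ∀ t → profile (const 1) t 0 ≡ B ^ t
    profile-first zero    = refl
    profile-first (suc t) = trans (profile-inside (const 1) t (B^t>0 t)) (cong (B *_) (profile-first t))

    total : (ℕ → ℕ) → ℕ → ℕ
    total u t = ∑ (B ^ t) (profile u t)

    -- The positions from `B ^ t` up to `B ^ suc t` form the new step, of length `B′ * B ^ t`; all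
    -- earlier steps are scaled by `B`.
    total-suc : ∀ u t → total u (suc t) ≡ B * total u t + B′ * B ^ t * u (suc t)
    total-suc u t = begin
      ∑ (B ^ t + B′ * B ^ t) (profile u (suc t))
        ≡⟨ cong (λ n → ∑ n (profile u (suc t))) (+-comm (B ^ t) (B′ * B ^ t)) ⟩
      ∑ (B′ * B ^ t + B ^ t) (profile u (suc t))
        ≡⟨ ∑-tail-const (B′ * B ^ t) (profile-outside u t) ⟩
      ∑ (B ^ t) (profile u (suc t)) + B′ * B ^ t * u (suc t)
        ≡⟨ cong (_+ B′ * B ^ t * u (suc t)) (∑-cong (B ^ t) (profile-inside u t)) ⟩
      ∑ (B ^ t) (λ j → B * profile u t j) + B′ * B ^ t * u (suc t)
        ≡⟨ cong (_+ B′ * B ^ t * u (suc t)) (∑-distribˡ B (profile u t) (B ^ t)) ⟩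
      B * total u t + B′ * B ^ t * u (suc t) ∎
      where open ≡-Reasoning

    total-const-1 : ∀ t → total (const 1) t ≤ suc t * B ^ t
    total-const-1 zero    = ≤-refl
    total-const-1 (suc t) = begin
      total (const 1) (suc t)
        ≡⟨ total-suc (const 1) t ⟩
      B * total (const 1) t + B′ * B ^ t * 1
        -- The new step sums to `B′ * B ^ t`, which is rounded up to `B * B ^ t`, the common bound
        -- for all steps.
        ≤⟨ +-mono-≤ (*-monoʳ-≤ B (total-const-1 t)) (≤-trans (≤-reflexive (*-identityʳ _)) (m≤n+m _ (B ^ t))) ⟩
      B * (suc t * B ^ t) + B * B ^ t
        ≡⟨ lemma B (suc t) (B ^ t) ⟩
      suc (suc t) * (B * B ^ t) ∎
      where
      open ≤-Reasoning
      lemma : ∀ b s p → b * (s * p) + b * p ≡ suc s * (b * p)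
      lemma = solve-∀

    -- Step k occupies the positions j with stepStart k ≤ j < stepStart (suc k).
    stepStart : ℕ → ℕ
    stepStart zero    = 0
    stepStart (suc k) = B ^ k

    stepStart-mono : ∀ k → stepStart k ≤ stepStart (suc k)
    stepStart-mono zero    = z≤n
    stepStart-mono (suc k) = ^-monoʳ-≤ B (n≤1+n k)

    -- Raising the steps that contain no query.

    module _ (qs : List ℕ) where

      -- In `profile`, the factor `B` lifts an unqueried step to the original height of the step
      -- before it, and step 0 to `B ^ suc t`.
      weight : ℕ → ℕ
      weight k with count (stepStart k) qs <? count (stepStart (suc k)) qs
      ... | yes _ = 1
      ... | no  _ = B

      -- The bound is exclusive: `unqueried (suc t)` covers all steps from 0 to `t`.
      unqueried : ℕ → ℕ
      unqueried zero    = 0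
      unqueried (suc k) with count (stepStart k) qs <? count (stepStart (suc k)) qs
      ... | yes _ = unqueried k
      ... | no  _ = suc (unqueried k)

      1≤weight : ∀ k → 1 ≤ weight k
      1≤weight k with count (stepStart k) qs <? count (stepStart (suc k)) qs
      ... | yes _ = ≤-refl
      ... | no  _ = s≤s z≤n

      weight≤B : ∀ k → weight k ≤ B
      weight≤B k with count (stepStart k) qs <? count (stepStart (suc k)) qs
      ... | yes _ = s≤s z≤n
      ... | no  _ = ≤-refl

      weight-queried : ∀ k {q} → q ∈ qs → stepStart k ≤ q → q < stepStart (suc k) → weight k ≡ 1
      weight-queried k q∈qs ≤q q< with count (stepStart k) qs <? count (stepStart (suc k)) qs
      ... | yes _ = refl
      ... | no ≮  = contradiction (count-strict q∈qs ≤q q<) ≮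

      profile-queried : ∀ t {q} → q ∈ qs → q < B ^ t → profile weight t q ≡ profile (const 1) t q
      profile-queried zero    q∈qs q<1 = weight-queried 0 q∈qs z≤n q<1
      profile-queried (suc t) {q} q∈qs q<B^ with q <? B ^ t
      ... | yes q<B^t = cong (B *_) (profile-queried t q∈qs q<B^t)
      ... | no  q≮B^t = weight-queried (suc t) q∈qs (≮⇒≥ q≮B^t) q<B^

      -- Each step adds one to `unqueried` or, if it holds a query, at least one to `count`.
      unqueried+count : ∀ k → k ≤ unqueried k + count (stepStart k) qs
      unqueried+count zero    = z≤n
      unqueried+count (suc k) with count (stepStart k) qs <? count (stepStart (suc k)) qs
      ... | yes c<c′ = begin
        suc k                                            ≤⟨ s≤s (unqueried+count k) ⟩
        suc (unqueried k + count (stepStart k) qs)           ≡⟨ +-suc _ _ ⟨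
        unqueried k + suc (count (stepStart k) qs)           ≤⟨ +-monoʳ-≤ _ c<c′ ⟩
        unqueried k + count (stepStart (suc k)) qs           ∎
        where open ≤-Reasoning
      ... | no  _    = s≤s (≤-trans (unqueried+count k) (+-monoʳ-≤ _ (count-mono qs (stepStart-mono k))))

      unqueried+length : ∀ k → k ≤ unqueried k + length qs
      unqueried+length k = ≤-trans (unqueried+count k) (+-monoʳ-≤ _ (count≤length (stepStart k) qs))

      -- For k > 0, an unqueried step k has length `B′ * B ^ (k - 1)` and raised height
      -- `B * B ^ (t - k)`, so its sum is `B′ * B ^ t`; an unqueried step 0 contributes `B * B ^ t`,
      -- which is more. Queried steps are bounded below by zero.
      total-weight : ∀ t → B′ * unqueried (suc t) * B ^ t ≤ total weight t
      total-weight zero with count 0 qs <? count 1 qs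
      ... | yes _ rewrite *-zeroʳ B′ = z≤n
      ... | no _  rewrite *-identityʳ B′ | *-identityʳ B′ | +-identityʳ B′ = n≤1+n B′
      -- The case split that follows also turns `weight (suc t)` in `eq` into 1 or `B`.
      total-weight (suc t) with ih ← total-weight t | eq ← total-suc weight t
        with count (B ^ t) qs <? count (B ^ suc t) qs
      ... | yes _ = begin
        B′ * unqueried (suc t) * (B * B ^ t)   ≡⟨ lemma B′ (unqueried (suc t)) B (B ^ t) ⟩
        B * (B′ * unqueried (suc t) * B ^ t)   ≤⟨ *-monoʳ-≤ B ih ⟩
        B * total weight t                     ≤⟨ m≤m+n _ _ ⟩
        B * total weight t + B′ * B ^ t * 1    ≡⟨ eq ⟨
        total weight (suc t)                   ∎
        where
        open ≤-Reasoning
        lemma : ∀ a c b p → a * c * (b * p) ≡ b * (a * c * p)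
        lemma = solve-∀
      ... | no  _ = begin
        B′ * suc (unqueried (suc t)) * (B * B ^ t)                ≡⟨ lemma B′ (unqueried (suc t)) B (B ^ t) ⟩
        B * (B′ * unqueried (suc t) * B ^ t) + B′ * B ^ t * B     ≤⟨ +-monoˡ-≤ _ (*-monoʳ-≤ B ih) ⟩
        B * total weight t + B′ * B ^ t * B                       ≡⟨ eq ⟨
        total weight (suc t)                                      ∎
        where
        open ≤-Reasoning
        lemma : ∀ a c b p → a * suc c * (b * p) ≡ b * (a * c * p) + a * p * b
        lemma = solve-∀

open StepFunctions

-- Order, inverses and embedded natural numbers in the constructive reals.

module RealProperties {c ℓ₁ ℓ₂} (ℛ : RealNumbers c ℓ₁ ℓ₂) where
  open RealNumbers ℛ
  private
    ring : CommutativeRing c ℓ₁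
    ring = HeytingCommutativeRing.commutativeRing heytingCommutativeRing
  open MultProperties (CommutativeRing.semiring ring) using (×-homo-+; ×1-homo-*)
  open RingProperties (CommutativeRing.ring ring) using (x[y-z]≈xy-xz)
  open HeytingProperties heytingCommutativeRing using (x-0≈x)
  open AbelianGroupProperties (CommutativeRing.+-abelianGroup ring) using (//-rightDividesˡ; //-rightDividesʳ)

  open StrictOrder public using (<-respˡ-≈; <-respʳ-≈; <-resp-≈) renaming
    (irrefl to <-irrefl; asym to <-asym)

  <⇒≤ : _<_ ⇒ _≤_
  <⇒≤ = <-asym

  -- Since `y ≤ z` is merely the negation of `z < y`, the strict conclusion has to come from
  -- cotransitivity.
  <-≤-trans : Trans _<_ _≤_ _<_
  <-≤-trans {k = z} x<y y≤z = [ id , flip contradiction y≤z ]′ (<-cotrans x<y z)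

  ≤-<-trans : Trans _≤_ _<_ _<_
  ≤-<-trans {x} x≤y y<z = [ flip contradiction x≤y , id ]′ (<-cotrans y<z x)

  ≤-isPreorder : IsPreorder _≈_ _≤_
  ≤-isPreorder = record
    { isEquivalence = isEquivalence
    ; reflexive     = λ x≈y → <-irrefl (sym x≈y)
    ; trans         = λ x≤y y≤z z<x → y≤z (<-≤-trans z<x x≤y)
    }

  open IsPreorder ≤-isPreorder public using () renaming
    (reflexive to ≤-reflexive; refl to ≤-refl; trans to ≤-trans)

  module ≤-Reasoning = Triple ≤-isPreorder <-asym StrictOrder.trans <-resp-≈ <⇒≤ <-≤-trans ≤-<-trans

  +-monoˡ-≤ : ∀ z {x y} → x ≤ y → x + z ≤ y + z
  +-monoˡ-≤ z {x} {y} x≤y y+z<x+z =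
    x≤y (<-respˡ-≈ (//-rightDividesʳ z y) (<-respʳ-≈ (//-rightDividesʳ z x) (+-monoˡ-< (- z) y+z<x+z)))

  +-mono-≤ : ∀ {x y u v} → x ≤ y → u ≤ v → x + u ≤ y + v
  +-mono-≤ {x} {y} {u} {v} x≤y u≤v = begin
    x + u ≤⟨ +-monoˡ-≤ u x≤y ⟩
    y + u ≈⟨ +-comm y u ⟩
    u + y ≤⟨ +-monoˡ-≤ y u≤v ⟩
    v + y ≈⟨ +-comm v y ⟩
    y + v ∎
    where open ≤-Reasoning

  *-monoʳ-< : ∀ {z} → 0# < z → ∀ {x y} → x < y → z * x < z * y
  *-monoʳ-< {z} 0<z {x} {y} x<y = begin-strict
    z * x                   ≈⟨ +-identityˡ _ ⟨
    0# + z * x              <⟨ +-monoˡ-< (z * x) (*-pos 0<z 0<y-x) ⟩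
    z * (y - x) + z * x     ≈⟨ +-congʳ (x[y-z]≈xy-xz z y x) ⟩
    z * y - z * x + z * x   ≈⟨ //-rightDividesˡ (z * x) (z * y) ⟩
    z * y                   ∎
    where
    open ≤-Reasoning
    0<y-x : 0# < y - x
    0<y-x = <-respˡ-≈ (-‿inverseʳ x) (+-monoˡ-< (- x) x<y)

  inv-inverseʳ : ∀ x (0<x : 0# < x) → x * inv x 0<x ≈ 1#
  inv-inverseʳ x 0<x = trans (*-congʳ (sym (x-0≈x x))) (proj₂ (proj₂ (#⇒invertible (#-sym (<⇒# 0<x)))))

  inv-inverseˡ : ∀ x (0<x : 0# < x) → inv x 0<x * x ≈ 1#
  inv-inverseˡ x 0<x = trans (*-comm _ _) (inv-inverseʳ x 0<x)

  -- The inverse is itself invertible, hence apart from zero; if it were negative, multiplying by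
  -- `x` would give 1 < 0.
  inv-pos : ∀ x (0<x : 0# < x) → 0# < inv x 0<x
  inv-pos x 0<x = [ flip contradiction inv≮0 , id ]′ (#⇒<⊎> inv#0)
    where
    inv#0 : inv x 0<x # 0#
    inv#0 = invertible⇒# (x , trans (*-congˡ (x-0≈x _)) (inv-inverseʳ x 0<x)
                            , trans (*-congʳ (x-0≈x _)) (inv-inverseˡ x 0<x))
    inv≮0 : ¬ inv x 0<x < 0#
    inv≮0 inv<0 = <-asym 0<1 (<-respˡ-≈ (inv-inverseʳ x 0<x) (<-respʳ-≈ (zeroʳ x) (*-monoʳ-< 0<x inv<0)))

  inv-cancelˡ : ∀ x (0<x : 0# < x) y → inv x 0<x * (x * y) ≈ y
  inv-cancelˡ x 0<x y = trans (sym (*-assoc _ _ _)) (trans (*-congʳ (inv-inverseˡ x 0<x)) (*-identityˡ y))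

  inv-cancelʳ : ∀ x (0<x : 0# < x) y → x * (inv x 0<x * y) ≈ y
  inv-cancelʳ x 0<x y = trans (sym (*-assoc _ _ _)) (trans (*-congʳ (inv-inverseʳ x 0<x)) (*-identityˡ y))

  *-monoʳ-≤ : ∀ {z} → 0# < z → ∀ {x y} → x ≤ y → z * x ≤ z * y
  *-monoʳ-≤ {z} 0<z {x} {y} x≤y zy<zx =
    x≤y (<-respˡ-≈ (inv-cancelˡ z 0<z y) (<-respʳ-≈ (inv-cancelˡ z 0<z x) (*-monoʳ-< (inv-pos z 0<z) zy<zx)))

  fromℕ-homo-+ : ∀ m n → fromℕ (m ℕ.+ n) ≈ fromℕ m + fromℕ n
  fromℕ-homo-+ = ×-homo-+ 1#

  fromℕ-homo-* : ∀ m n → fromℕ (m ℕ.* n) ≈ fromℕ m * fromℕ n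
  fromℕ-homo-* = ×1-homo-*

  fromℕ-nonneg : ∀ n → 0# ≤ fromℕ n
  fromℕ-nonneg zero    = ≤-refl
  fromℕ-nonneg (suc n) = <⇒≤ (fromℕ-pos (suc n) (s≤s z≤n))

  fromℕ-mono-≤ : ∀ {m n} → m ℕ.≤ n → fromℕ m ≤ fromℕ n
  fromℕ-mono-≤ {n = n} z≤n = fromℕ-nonneg n
  fromℕ-mono-≤ (s≤s m≤n)   = +-mono-≤ ≤-refl (fromℕ-mono-≤ m≤n)

  fromℕ-mono-< : ∀ {m n} → m ℕ.< n → fromℕ m < fromℕ n
  fromℕ-mono-< {m} {n} m<n = begin-strict
    fromℕ m       ≈⟨ +-identityˡ _ ⟨
    0# + fromℕ m  <⟨ +-monoˡ-< (fromℕ m) 0<1 ⟩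
    1# + fromℕ m  ≤⟨ fromℕ-mono-≤ m<n ⟩
    fromℕ n       ∎
    where open ≤-Reasoning

  fromℕ-cancel-≤ : ∀ {m n} → fromℕ m ≤ fromℕ n → m ℕ.≤ n
  fromℕ-cancel-≤ m≤n = ℕ.≮⇒≥ (m≤n ∘ fromℕ-mono-<)

  fromℕ-cancel-< : ∀ {m n} → fromℕ m < fromℕ n → m ℕ.< n
  fromℕ-cancel-< m<n = ℕ.≰⇒> λ n≤m → fromℕ-mono-≤ n≤m m<n

  fromℕ1≈1 : fromℕ 1 ≈ 1#
  fromℕ1≈1 = +-identityʳ 1#

  -- Upper bounds for the binary logarithm.

  module _ (L : BinaryLogarithm ℛ) where
    open BinaryLogarithm L

    -- From 1 * 1 = 1 follows `l + l ≤ l`, which excludes `0# < l`.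
    log₂-1≤0 : (0<1′ : 0# < fromℕ 1) → log₂ (fromℕ 1) 0<1′ ≤ 0#
    log₂-1≤0 0<1′ 0<l = contradiction (+-monoˡ-< l 0<l) λ 0+l<l+l → log≤ (<-respˡ-≈ (+-identityˡ l) 0+l<l+l)
      where
      l : ℝ
      l = log₂ (fromℕ 1) 0<1′
      log≤ : l + l ≤ l
      log≤ = ≤-trans (≤-reflexive (sym (log₂-* 0<1′ 0<1′)))
                     (log₂-mono _ 0<1′ (≤-reflexive (trans (*-congʳ fromℕ1≈1) (*-identityˡ _))))

    -- Monotonicity, applied to equal numbers, serves as congruence of `log₂`, also between
    -- different positivity proofs.
    log₂-2^ : ∀ k 0<2^k → log₂ (fromℕ (2 ℕ.^ k)) 0<2^k ≤ fromℕ k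
    log₂-2^ zero    0<1′  = log₂-1≤0 0<1′
    log₂-2^ (suc k) 0<2^k = begin
      log₂ (fromℕ (2 ℕ.* 2 ℕ.^ k)) 0<2^k            ≤⟨ log₂-mono _ (*-pos 0<2 0<2^) (≤-reflexive (fromℕ-homo-* 2 (2 ℕ.^ k))) ⟩
      log₂ (fromℕ 2 * fromℕ (2 ℕ.^ k)) _            ≈⟨ log₂-* 0<2 0<2^ ⟩
      log₂ (fromℕ 2) 0<2 + log₂ (fromℕ (2 ℕ.^ k)) _ ≤⟨ +-mono-≤ (≤-reflexive log₂-2) (log₂-2^ k 0<2^) ⟩
      1# + fromℕ k                                  ∎
      where
      open ≤-Reasoning
      0<2 : 0# < fromℕ 2
      0<2 = fromℕ-pos 2 (s≤s z≤n)
      0<2^ : 0# < fromℕ (2 ℕ.^ k)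
      0<2^ = fromℕ-pos (2 ℕ.^ k) (ℕ.m^n>0 2 k)

    log₂-≤ : ∀ k {x} (0<x : 0# < x) → x ≤ fromℕ (2 ℕ.^ k) → log₂ x 0<x ≤ fromℕ k
    log₂-≤ k 0<x x≤2^k = ≤-trans (log₂-mono 0<x 0<2^k x≤2^k) (log₂-2^ k 0<2^k)
      where
      0<2^k : 0# < fromℕ (2 ℕ.^ k)
      0<2^k = fromℕ-pos (2 ℕ.^ k) (ℕ.m^n>0 2 k)

-- Positions counted from the large end of the list.

-- By computation, the head of a vector of length `suc n` has position `n` and the tail keeps its
-- positions. Sums over a vector thus unfold in the same order as `∑`.
positionFromEnd : ∀ {n} → Fin n → ℕ
positionFromEnd {n} i = n ℕ.∸ suc (toℕ i)

positionFromEnd-surjective : ∀ {n j} → j ℕ.< n → ∃[ i ] positionFromEnd {n} i ≡ j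
positionFromEnd-surjective {n} {j} j<n = opposite (fromℕ< j<n) ,
  (begin
    n ℕ.∸ suc (toℕ (opposite (fromℕ< j<n))) ≡⟨ opposite-prop (opposite (fromℕ< j<n)) ⟨
    toℕ (opposite (opposite (fromℕ< j<n)))  ≡⟨ ≡.cong toℕ (opposite-involutive (fromℕ< j<n)) ⟩
    toℕ (fromℕ< j<n)                        ≡⟨ toℕ-fromℕ< j<n ⟩
    j                                       ∎)
  where open ≡.≡-Reasoning

positionFromEnd-antitone : ∀ {n} {i j : Fin n} → i Fin.≤ j → positionFromEnd j ℕ.≤ positionFromEnd i
positionFromEnd-antitone {n} i≤j = ℕ.∸-monoʳ-≤ n (s≤s i≤j)

-- Decision trees cannot distinguish inputs that agree on the queried entries.

module DecisionTreeProperties {c ℓ₁ ℓ₂} (ℛ : RealNumbers c ℓ₁ ℓ₂) where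
  open RealNumbers ℛ
  open SortedSum ℛ

  queried : ∀ {n} → DecisionTree n → Vector ℝ n → List (Fin n)
  queried (output s)  a = []
  queried (query i k) a = i ∷ queried (k (a i)) a

  length-queried : ∀ {n} (T : DecisionTree n) a → length (queried T a) ≡ queries T a
  length-queried (output s)  a = ≡.refl
  length-queried (query i k) a = ≡.cong suc (length-queried (k (a i)) a)

  -- Equal answers lead into the same subtree, so the queries made on `a` are also those made on
  -- `b`. Agreement is up to `≡` because a continuation need not respect `≈`.
  run-cong : ∀ {n} (T : DecisionTree n) {a b} → (∀ {i} → i ∈ queried T a → b i ≡ a i) → run T b ≡ run T a
  run-cong (output s)  b≗a = ≡.refl
  run-cong (query i k) {a} {b} b≗a rewrite b≗a (here ≡.refl) = run-cong (k (a i)) (b≗a ∘ there)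

-- The hard input and its properties.

-- X is the largest entry of the hard input; it is also the number of entries
-- that lie on a step, so that the additional entry ε is at position X.
module HardInput {c ℓ₁ ℓ₂} (ℛ : RealNumbers c ℓ₁ ℓ₂) (B′ t : ℕ)
  (R : RealNumbers.ℝ ℛ) (1≤R : RealNumbers._≤_ ℛ (RealNumbers.1# ℛ) R)
  (X≤R : RealNumbers._≤_ ℛ (RealNumbers.fromℕ ℛ (suc B′ ℕ.^ t)) R) where
  open RealNumbers ℛ
  open SortedSum ℛ
  open RealProperties ℛ
  open Profile B′

  X : ℕ
  X = B ℕ.^ t

  0<R : 0# < R
  0<R = 1≤⇒0< 1≤R

  0<X : 0# < fromℕ X
  0<X = fromℕ-pos X (B^t>0 t)

  ε : ℝ
  ε = fromℕ X * inv R 0<R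

  0<ε : 0# < ε
  0<ε = *-pos 0<X (inv-pos R 0<R)

  ε≤1 : ε ≤ fromℕ 1
  ε≤1 = begin
    fromℕ X * inv R 0<R  ≈⟨ *-comm _ _ ⟩
    inv R 0<R * fromℕ X  ≤⟨ *-monoʳ-≤ (inv-pos R 0<R) X≤R ⟩
    inv R 0<R * R        ≈⟨ inv-inverseˡ R 0<R ⟩
    1#                   ≈⟨ fromℕ1≈1 ⟨
    fromℕ 1              ∎
    where open ≤-Reasoning

  ratio : fromℕ X * inv ε 0<ε ≈ R
  ratio = begin-equality
    fromℕ X * inv ε 0<ε                        ≈⟨ *-congʳ (inv-cancelʳ R 0<R (fromℕ X)) ⟨
    R * (inv R 0<R * fromℕ X) * inv ε 0<ε      ≈⟨ *-congʳ (*-congˡ (*-comm _ _)) ⟩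
    R * ε * inv ε 0<ε                          ≈⟨ *-assoc _ _ _ ⟩
    R * (ε * inv ε 0<ε)                        ≈⟨ *-congˡ (inv-inverseʳ ε 0<ε) ⟩
    R * 1#                                     ≈⟨ *-identityʳ R ⟩
    R                                          ∎
    where open ≤-Reasoning

  entry : (ℕ → ℕ) → ℕ → ℝ
  entry u j with ℕ.<-cmp j X
  ... | tri< _ _ _ = fromℕ (profile u t j)
  ... | tri≈ _ _ _ = ε
  ... | tri> _ _ _ = 0#

  entry-inside : ∀ u {j} → j ℕ.< X → entry u j ≡ fromℕ (profile u t j)
  entry-inside u {j} j<X with ℕ.<-cmp j X
  ... | tri< _ _ _   = ≡.refl
  ... | tri≈ j≮X _ _ = contradiction j<X j≮X
  ... | tri> j≮X _ _ = contradiction j<X j≮X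

  entry-boundary : ∀ u → entry u X ≡ ε
  entry-boundary u with ℕ.<-cmp X X
  ... | tri< _ X≢X _ = contradiction ≡.refl X≢X
  ... | tri≈ _ _ _   = ≡.refl
  ... | tri> _ X≢X _ = contradiction ≡.refl X≢X

  entry-beyond : ∀ u {j} → X ℕ.< j → entry u j ≡ 0#
  entry-beyond u {j} X<j with ℕ.<-cmp j X
  ... | tri< _ _ X≮j = contradiction X<j X≮j
  ... | tri≈ _ _ X≮j = contradiction X<j X≮j
  ... | tri> _ _ _   = ≡.refl

  entry-nonneg : ∀ u j → 0# ≤ entry u j
  entry-nonneg u j with ℕ.<-cmp j X
  ... | tri< _ _ _ = fromℕ-nonneg (profile u t j)
  ... | tri≈ _ _ _ = <⇒≤ 0<ε
  ... | tri> _ _ _ = ≤-refl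

  entry-antitone : ∀ {u} → (∀ k → 1 ℕ.≤ u k) → (∀ k → u k ℕ.≤ B) →
                   ∀ {i j} → i ℕ.≤ j → entry u j ≤ entry u i
  entry-antitone {u} 1≤u u≤B {i} {j} i≤j with ℕ.<-cmp i X | ℕ.<-cmp j X
  ... | tri< _ _ _      | tri< _ _ _      = fromℕ-mono-≤ (profile-antitone 1≤u u≤B t i≤j)
  -- This is where `X≤R` matters: it gives `ε ≤ 1`, and no step is lower than 1.
  ... | tri< _ _ _      | tri≈ _ _ _      = ≤-trans ε≤1 (fromℕ-mono-≤ (profile-pos 1≤u t i))
  ... | tri< _ _ _      | tri> _ _ _      = fromℕ-nonneg (profile u t i)
  ... | tri≈ _ ≡.refl _ | tri< j<X _ _    = contradiction j<X (ℕ.≤⇒≯ i≤j)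
  ... | tri≈ _ _ _      | tri≈ _ _ _      = ≤-refl
  ... | tri≈ _ _ _      | tri> _ _ _      = <⇒≤ 0<ε
  ... | tri> _ _ X<i    | tri< j<X _ _    = contradiction (ℕ.<-trans j<X X<i) (ℕ.≤⇒≯ i≤j)
  ... | tri> _ _ X<i    | tri≈ _ ≡.refl _ = contradiction X<i (ℕ.≤⇒≯ i≤j)
  ... | tri> _ _ _      | tri> _ _ _      = ≤-refl

  entry-1-antitone : ∀ {i j} → i ℕ.≤ j → entry (const 1) j ≤ entry (const 1) i
  entry-1-antitone = entry-antitone (λ _ → ℕ.≤-refl) (λ _ → s≤s z≤n)

  input : (ℕ → ℕ) → ∀ n → Vector ℝ n
  input u n i = entry u (positionFromEnd i)

  isInput : ∀ {u} → (∀ k → 1 ℕ.≤ u k) → (∀ k → u k ℕ.≤ B) → ∀ n → IsInput (input u n)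
  isInput 1≤u u≤B n = record
    { nonneg = λ i → entry-nonneg _ (positionFromEnd i)
    ; sorted = λ i≤j → entry-antitone 1≤u u≤B (positionFromEnd-antitone i≤j)
    }

  sum-upto : ∀ u {n} → n ℕ.≤ X → sum (input u n) ≈ fromℕ (∑ n (profile u t))
  sum-upto u {zero}  _   = refl
  sum-upto u {suc n} n<X = trans
    (+-cong (reflexive (entry-inside u n<X)) (sum-upto u (ℕ.<⇒≤ n<X)))
    (sym (fromℕ-homo-+ (profile u t n) _))

  -- The vector begins with its smallest entries: `k` zeros, then `ε`, then the steps.
  sum-full : ∀ u k → sum (input u (k ℕ.+ suc X)) ≈ ε + fromℕ (total u t)
  sum-full u zero    = +-cong (reflexive (entry-boundary u)) (sum-upto u ℕ.≤-refl)
  sum-full u (suc k) = trans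
    (+-cong (reflexive (entry-beyond u (ℕ.m≤n+m (suc X) k))) (sum-full u k))
    (+-identityˡ _)

  module _ {n} (X<n : X ℕ.< n) where

    sum-input : ∀ u → sum (input u n) ≈ ε + fromℕ (total u t)
    sum-input u = ≡.subst (λ n → sum (input u n) ≈ ε + fromℕ (total u t))
                          (ℕ.m∸n+n≡m X<n) (sum-full u (n ℕ.∸ suc X))

    hardInput : Vector ℝ n
    hardInput = input (const 1) n

    isInput-hardInput : IsInput hardInput
    isInput-hardInput = isInput (λ _ → ℕ.≤-refl) (λ _ → s≤s z≤n) n

    largest-hardInput : IsLargestPositive hardInput (fromℕ X)
    largest-hardInput = record
      { positive = 0<X
      ; attained = let (i , i≡0) = positionFromEnd-surjective (ℕ.<-trans (B^t>0 t) X<n) in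
                   i , reflexive (≡.trans (≡.cong (entry (const 1)) i≡0) entry-0)
      ; largest  = λ i _ → ≤-trans (entry-1-antitone {0} {positionFromEnd i} z≤n)
                                   (≤-reflexive (reflexive entry-0))
      }
      where
      entry-0 : entry (const 1) 0 ≡ fromℕ X
      entry-0 = ≡.trans (entry-inside (const 1) (B^t>0 t)) (≡.cong fromℕ (profile-first t))

    least-hardInput : IsLeastPositive hardInput ε
    least-hardInput = record
      { positive = 0<ε
      ; attained = let (i , i≡X) = positionFromEnd-surjective X<n in
                   i , reflexive (≡.trans (≡.cong (entry (const 1)) i≡X) (entry-boundary (const 1)))
      ; least    = λ i → least (positionFromEnd i)
      }
      where
      least : ∀ j → 0# < entry (const 1) j → ε ≤ entry (const 1) j
      least j 0<e with j ℕ.≤? X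
      ... | yes j≤X = ≤-trans (≤-reflexive (reflexive (≡.sym (entry-boundary (const 1)))))
                              (entry-1-antitone j≤X)
      ... | no  j≰X = contradiction 0<e (<-irrefl (reflexive (≡.sym (entry-beyond (const 1) (ℕ.≰⇒> j≰X)))))

    -- The adversary argument.

    module _ (d : ℝ) (0<d : 0# < d) (M : ℕ) (d²<M : d * d < fromℕ M) (4M≤B′ : 4 ℕ.* M ℕ.≤ B′)
             (T : DecisionTree n)
             (approx : ∀ a → IsInput a → IsApproximation d 0<d a (run T a)) where
      open DecisionTreeProperties ℛ

      private
        qs : List ℕ
        qs = map positionFromEnd (queried T hardInput)

        raisedInput : Vector ℝ n
        raisedInput = input (weight qs) n

        entry-queried : ∀ {j} → j ∈ qs → entry (weight qs) j ≡ entry (const 1) j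
        entry-queried {j} j∈qs with ℕ.<-cmp j X
        ... | tri< j<X _ _ = ≡.cong fromℕ (profile-queried qs t j∈qs j<X)
        ... | tri≈ _ _ _   = ≡.refl
        ... | tri> _ _ _   = ≡.refl

        same-run : run T raisedInput ≡ run T hardInput
        same-run = run-cong T (entry-queried ∘ ∈-map⁺ positionFromEnd)

        length-qs : length qs ≡ queries T hardInput
        length-qs = ≡.trans (length-map positionFromEnd (queried T hardInput)) (length-queried T hardInput)

        -- One and the same output approximates both sums, so each approximation costs a factor `d`.
        sum-raised≤ : sum raisedInput ≤ d * (d * sum hardInput)
        sum-raised≤ = begin
          sum raisedInput                        ≈⟨ inv-cancelʳ d 0<d _ ⟨
          d * (inv d 0<d * sum raisedInput)      ≤⟨ *-monoʳ-≤ 0<d (proj₁ (approx raisedInput (isInput (1≤weight qs) (weight≤B qs) n))) ⟩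
          d * run T raisedInput                  ≡⟨ ≡.cong (d *_) same-run ⟩
          d * run T hardInput                    ≤⟨ *-monoʳ-≤ 0<d (proj₂ (approx hardInput isInput-hardInput)) ⟩
          d * (d * sum hardInput)                ∎
          where open ≤-Reasoning

        -- The comparison moves to natural numbers by replacing `ε` with 0 on the raised side and
        -- with 1 on the original side.
        total≤ : total (weight qs) t ℕ.≤ M ℕ.* suc (total (const 1) t)
        total≤ = fromℕ-cancel-≤ (begin
          fromℕ (total (weight qs) t)                ≈⟨ +-identityˡ _ ⟨
          0# + fromℕ (total (weight qs) t)           ≤⟨ +-monoˡ-≤ _ (<⇒≤ 0<ε) ⟩
          ε + fromℕ (total (weight qs) t)            ≈⟨ sum-input (weight qs) ⟨
          sum raisedInput                            ≤⟨ sum-raised≤ ⟩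
          d * (d * sum hardInput)                    ≈⟨ *-assoc d d _ ⟨
          d * d * sum hardInput                      ≈⟨ *-congˡ (sum-input (const 1)) ⟩
          d * d * (ε + fromℕ (total (const 1) t))    ≤⟨ *-monoʳ-≤ (*-pos 0<d 0<d) (+-monoˡ-≤ _ (≤-trans ε≤1 (≤-reflexive fromℕ1≈1))) ⟩
          d * d * fromℕ (suc (total (const 1) t))    ≈⟨ *-comm _ _ ⟩
          fromℕ (suc (total (const 1) t)) * (d * d)  ≤⟨ *-monoʳ-≤ (fromℕ-pos (suc (total (const 1) t)) (s≤s z≤n)) (<⇒≤ d²<M) ⟩
          fromℕ (suc (total (const 1) t)) * fromℕ M  ≈⟨ *-comm _ _ ⟩
          fromℕ M * fromℕ (suc (total (const 1) t))  ≈⟨ fromℕ-homo-* M (suc (total (const 1) t)) ⟨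
          fromℕ (M ℕ.* suc (total (const 1) t))      ∎)
          where open ≤-Reasoning

        0<M : 0 ℕ.< M
        0<M = fromℕ-cancel-< (StrictOrder.trans (*-pos 0<d 0<d) d²<M)

        -- Each unqueried step adds at least `B′ * X`, hence at least `4 * M * X`, to the raised
        -- total, while that total is at most `2 * M * X * suc t`.
        few-unqueried : 2 ℕ.* unqueried qs (suc t) ℕ.≤ suc t
        few-unqueried = ℕ.*-cancelˡ-≤ (2 ℕ.* M ℕ.* X) {{ℕ.>-nonZero 0<2MX}} (begin
          2 ℕ.* M ℕ.* X ℕ.* (2 ℕ.* U)          ≡⟨ lemma₁ M X U ⟩
          4 ℕ.* M ℕ.* U ℕ.* X                  ≤⟨ ℕ.*-monoˡ-≤ X (ℕ.*-monoˡ-≤ U 4M≤B′) ⟩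
          B′ ℕ.* U ℕ.* X                       ≤⟨ total-weight qs t ⟩
          total (weight qs) t                  ≤⟨ total≤ ⟩
          -- The extra 1, which stands for `ε`, is absorbed by 1 ≤ `X` ≤ `suc t * X`; this doubles
          -- the bound.
          M ℕ.* suc (total (const 1) t)        ≤⟨ ℕ.*-monoʳ-≤ M (ℕ.+-mono-≤ (ℕ.≤-trans (B^t>0 t) (ℕ.m≤m+n X _)) (total-const-1 t)) ⟩
          M ℕ.* (suc t ℕ.* X ℕ.+ suc t ℕ.* X)  ≡⟨ lemma₂ M X (suc t) ⟩
          2 ℕ.* M ℕ.* X ℕ.* suc t              ∎)
          where
          open ℕ.≤-Reasoning
          U : ℕ
          U = unqueried qs (suc t)
          0<2MX : 0 ℕ.< 2 ℕ.* M ℕ.* X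
          0<2MX = ℕ.*-mono-< (ℕ.*-mono-< {0} {2} (s≤s z≤n) 0<M) (B^t>0 t)
          lemma₁ : ∀ m x u → 2 ℕ.* m ℕ.* x ℕ.* (2 ℕ.* u) ≡ 4 ℕ.* m ℕ.* u ℕ.* x
          lemma₁ = solve-∀
          lemma₂ : ∀ m x s → m ℕ.* (s ℕ.* x ℕ.+ s ℕ.* x) ≡ 2 ℕ.* m ℕ.* x ℕ.* s
          lemma₂ = solve-∀

      blocks≤2*queries : suc t ℕ.≤ 2 ℕ.* queries T hardInput
      -- With `suc t` added on both sides, the left side becomes twice the number of steps, which
      -- splits into unqueried and queried ones.
      blocks≤2*queries = ℕ.+-cancelˡ-≤ (suc t) _ _ (begin
        suc t ℕ.+ suc t                                   ≡⟨ lemma (suc t) ⟩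
        2 ℕ.* suc t                                       ≤⟨ ℕ.*-monoʳ-≤ 2 (unqueried+length qs (suc t)) ⟩
        2 ℕ.* (unqueried qs (suc t) ℕ.+ length qs)        ≡⟨ ℕ.*-distribˡ-+ 2 (unqueried qs (suc t)) _ ⟩
        2 ℕ.* unqueried qs (suc t) ℕ.+ 2 ℕ.* length qs    ≤⟨ ℕ.+-monoˡ-≤ _ few-unqueried ⟩
        suc t ℕ.+ 2 ℕ.* length qs                         ≡⟨ ≡.cong (λ l → suc t ℕ.+ 2 ℕ.* l) length-qs ⟩
        suc t ℕ.+ 2 ℕ.* queries T hardInput               ∎)
        where
        open ℕ.≤-Reasoning
        lemma : ∀ s → s ℕ.+ s ≡ 2 ℕ.* s
        lemma = solve-∀

-- The choice of `t` for given `n` and `R`, and the lower bound.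

module _ {c ℓ₁ ℓ₂} (ℛ : RealNumbers c ℓ₁ ℓ₂) where
  open RealNumbers ℛ
  open RealProperties ℛ

  -- The real R cannot be compared with a power of b exactly, hence the slack of
  -- one power in the last alternative.
  maximal-power : ∀ b → 1 ℕ.< b → ∀ n → 1 ℕ.< n → ∀ R → 1# ≤ R →
    ∃[ t ] b ℕ.^ t ℕ.< n × fromℕ (b ℕ.^ t) ≤ R × (n ℕ.≤ b ℕ.^ suc t ⊎ R ≤ fromℕ (b ℕ.^ suc (suc t)))
  maximal-power b 1<b n 1<n R 1≤R =
    search n 0 (ℕ.m≤m+n n 0) 1<n (≤-trans (≤-reflexive fromℕ1≈1) 1≤R)
    where
    search : ∀ fuel t → n ℕ.≤ fuel ℕ.+ t → b ℕ.^ t ℕ.< n → fromℕ (b ℕ.^ t) ≤ R →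
      ∃[ t ] b ℕ.^ t ℕ.< n × fromℕ (b ℕ.^ t) ≤ R × (n ℕ.≤ b ℕ.^ suc t ⊎ R ≤ fromℕ (b ℕ.^ suc (suc t)))
    -- The search cannot run out of fuel: `n` ≤ `t` < `b ^ t` < `n` is impossible.
    search zero t n≤t b^t<n b^t≤R =
      contradiction (ℕ.≤-trans n≤t (ℕ.<⇒≤ (n<m^n 1<b t))) (ℕ.<⇒≱ b^t<n)
    search (suc fuel) t n≤ b^t<n b^t≤R with n ℕ.≤? b ℕ.^ suc t
    ... | yes n≤b^ = t , b^t<n , b^t≤R , inj₁ n≤b^
    ... | no  n≰b^
      -- Cotransitivity places `R` above the lower or below the upper of two consecutive powers.
      with <-cotrans (fromℕ-mono-< (ℕ.^-monoʳ-< b 1<b (ℕ.n<1+n (suc t)))) R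
    ...   | inj₁ b^<R = search fuel (suc t) (ℕ.≤-trans n≤ (ℕ.≤-reflexive (≡.sym (ℕ.+-suc fuel t))))
                               (ℕ.≰⇒> n≰b^) (<⇒≤ b^<R)
    ...   | inj₂ R<b^ = t , b^t<n , b^t≤R , inj₂ (<⇒≤ R<b^)

-- The constant depends on `d` alone, and the hard input is found for every `n` > 1 and every
-- prescribed ratio `R` ≥ 1, so the two logarithms vary independently.
theorem2 :
    ∀ {c ℓ₁ ℓ₂} (ℛ : RealNumbers c ℓ₁ ℓ₂) (L : BinaryLogarithm ℛ) →
    let open RealNumbers ℛ
        open BinaryLogarithm L
        open SortedSum ℛ
    in
    (d : ℝ) (1<d : 1# < d) →
    Σ[ C ∈ ℝ ] 0# < C ×
      ((A : Algorithm) → IsApproximationAlgorithm d (1<⇒0< 1<d) A →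
       (n : ℕ) (1<n : 1 ℕ.< n) (R : ℝ) (1≤R : 1# ≤ R) →
       Σ[ a ∈ Vector ℝ n ] IsInput a ×
       Σ[ xmax ∈ ℝ ] Σ[ xmin ∈ ℝ ]
       Σ[ max ∈ IsLargestPositive a xmax ] Σ[ min ∈ IsLeastPositive a xmin ]
         xmax * inv xmin (IsLeastPositive.positive min) ≈ R ×
         C * (log₂ (fromℕ n) (fromℕ-pos n (<-trans (n<1+n 0) 1<n)) ⊓ log₂ R (1≤⇒0< 1≤R))
           ≤ fromℕ (queries (A n) a))
theorem2 ℛ L d 1<d with RealNumbers.archimedean ℛ (RealNumbers._*_ ℛ d d)
-- The constant is 1 / (4b): the minimum of the logarithms is at most b(t + 2), and t + 2 is at most
-- four times the number of queries.
... | M , d²<M = inv (fromℕ (4 ℕ.* b)) 0<4b , inv-pos _ 0<4b , λ A approx n 1<n R 1≤R →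
  let (t , X<n , X≤R , maximal) = maximal-power ℛ (suc B′) 1<B n 1<n R 1≤R
      module H = HardInput ℛ B′ t R 1≤R X≤R
      q = queries (A n) (H.hardInput X<n)
      1+t≤2q = H.blocks≤2*queries X<n d 0<d M d²<M 4M≤B′ (A n) (approx n)
  in H.hardInput X<n , H.isInput-hardInput X<n , fromℕ H.X , H.ε ,
     H.largest-hardInput X<n , H.least-hardInput X<n , H.ratio ,
     ≤-trans (*-monoʳ-≤ (inv-pos _ 0<4b) (begin
         log₂ (fromℕ n) _ ⊓ log₂ R _       ≤⟨ log-bound t n _ R _ maximal ⟩
         fromℕ (b ℕ.* suc (suc t))         ≤⟨ fromℕ-mono-≤ (levels≤ t q 1+t≤2q) ⟩
         fromℕ (4 ℕ.* b ℕ.* q)             ≈⟨ fromℕ-homo-* (4 ℕ.* b) q ⟩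
         fromℕ (4 ℕ.* b) * fromℕ q         ∎))
       (≤-reflexive (inv-cancelˡ (fromℕ (4 ℕ.* b)) 0<4b (fromℕ q)))
  where
  open RealNumbers ℛ
  open BinaryLogarithm L
  open SortedSum ℛ
  open RealProperties ℛ
  open ≤-Reasoning

  0<d : 0# < d
  0<d = 1<⇒0< 1<d

  0<M : 0 ℕ.< M
  0<M = fromℕ-cancel-< (StrictOrder.trans (*-pos 0<d 0<d) d²<M)

  -- Taking `B` to be the power of two with exponent `4 * M` makes the logarithm of `B ^ s` at most
  -- `b * s`, and `B′` at least `4 * M`.
  b B′ : ℕ
  b = 4 ℕ.* M
  B′ = ℕ.pred (2 ℕ.^ b)

  B≡2^b : suc B′ ≡ 2 ℕ.^ b
  B≡2^b = ℕ.suc-pred (2 ℕ.^ b) {{ℕ.m^n≢0 2 b}}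

  4M≤B′ : b ℕ.≤ B′
  4M≤B′ = ℕ.pred-mono-≤ (n<m^n ℕ.≤-refl b)

  0<b : 0 ℕ.< b
  0<b = ℕ.*-mono-< {0} {4} (s≤s z≤n) 0<M

  1<B : 1 ℕ.< suc B′
  1<B = s≤s (ℕ.≤-trans 0<b 4M≤B′)

  0<4b : 0# < fromℕ (4 ℕ.* b)
  0<4b = fromℕ-pos (4 ℕ.* b) (ℕ.*-mono-< {0} {4} (s≤s z≤n) 0<b)

  log₂-≤-B^ : ∀ s {x} (0<x : 0# < x) → x ≤ fromℕ (suc B′ ℕ.^ s) → log₂ x 0<x ≤ fromℕ (b ℕ.* s)
  log₂-≤-B^ s 0<x x≤ = log₂-≤ L (b ℕ.* s) 0<x
    (≤-trans x≤ (≤-reflexive (reflexive (≡.cong fromℕ (≡.trans (≡.cong (ℕ._^ s) B≡2^b) (ℕ.^-*-assoc 2 b s))))))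

  -- Whichever of `n` and `R` stopped the growth of `t`, its logarithm bounds the minimum.
  log-bound : ∀ t n 0<n R 0<R → n ℕ.≤ suc B′ ℕ.^ suc t ⊎ R ≤ fromℕ (suc B′ ℕ.^ suc (suc t)) →
              log₂ (fromℕ n) 0<n ⊓ log₂ R 0<R ≤ fromℕ (b ℕ.* suc (suc t))
  log-bound t n 0<n R 0<R (inj₁ n≤) = ≤-trans (proj₁ (⊓-infimum _ _))
    (≤-trans (log₂-≤-B^ (suc t) 0<n (fromℕ-mono-≤ n≤)) (fromℕ-mono-≤ (ℕ.*-monoʳ-≤ b (ℕ.n≤1+n (suc t)))))
  log-bound t n 0<n R 0<R (inj₂ R≤) = ≤-trans (proj₁ (proj₂ (⊓-infimum _ _))) (log₂-≤-B^ (suc (suc t)) 0<R R≤)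

  levels≤ : ∀ t q → suc t ℕ.≤ 2 ℕ.* q → b ℕ.* suc (suc t) ℕ.≤ 4 ℕ.* b ℕ.* q
  levels≤ t q 1+t≤2q = ℕ.≤-trans (ℕ.*-monoʳ-≤ b 2+t≤4q) (ℕ.≤-reflexive (lemma b q))
    where
    2+t≤4q : suc (suc t) ℕ.≤ 2 ℕ.* q ℕ.+ 2 ℕ.* q
    -- The slack of one power is paid for by 1 ≤ `2 * q`, which holds as at least one query is made.
    2+t≤4q = ℕ.+-mono-≤ (ℕ.≤-trans (s≤s z≤n) 1+t≤2q) 1+t≤2q
    lemma : ∀ b q → b ℕ.* (2 ℕ.* q ℕ.+ 2 ℕ.* q) ≡ 4 ℕ.* b ℕ.* q
    lemma = solve-∀
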